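{- Let $q$ be a prime power and let $n \geq 2$ be an integer. The girth of the graph $D(n,q)$ is at least $n+5$ when $n$ is odd, and at least $n+4$ when $n$ is even.
   Context: Let $\mathbb{F}_q$ be the finite field of order $q$, $q$ a prime power. For $n \geq 2$ let $P$ and $L$ be two disjoint copies of $\mathbb{F}_q^n$; elements of $P$ are called points and written $(p)=(p_1,\dots,p_n)$, and elements of $L$ are called lines and written $[\ell]=[\ell_1,\dots,\ell_n]$. The graph $D(n,q)$ is the simple undirected bipartite graph with vertex set $P \sqcup L$ (parts $P$ and $L$) in which the point $(p)$ is adjacent to the line $[\ell]$ if and only if the following $n-1$ equations hold (only those with index at most $n$ are imposed): $$p_2+\ell_2 = p_1\ell_1,\qquad p_3+\ell_3 = p_1\ell_2,$$ and for $4 \leq j \leq n$, $$p_j+\ell_j = \begin{cases} p_{j-2}\,\ell_1 & \text{if } j\equiv 0,1 \pmod 4,\\ p_1\,\ell_{j-2} & \text{if } j \equiv 2,3 \pmod 4.\end{cases}$$ The girth of a graph containing at least one cycle is the length of a shortest cycle in it. -}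

module Defs where

open import Level using (Level; _⊔_) renaming (suc to lsuc)
open import Algebra.Bundles using (CommutativeRing)
import Algebra.Definitions as AlgebraDefinitions
open import Data.Empty.Polymorphic using (⊥)
open import Data.Fin.Base using (Fin; zero; suc; toℕ)
open import Data.Nat.Base using (ℕ; zero; suc; _∸_; _^_; _≤_; _%_)
open import Data.Nat.Primality using (Prime)
open import Data.Product.Base using (∃-syntax; _×_)
open import Data.Sum.Base using (_⊎_; inj₁; inj₂)
import Data.Sum.Relation.Binary.Pointwise as Sum
open import Data.Vec.Functional using (Vector; tail)
import Data.Vec.Functional.Relation.Binary.Equality.Setoid as VecEq
open import Function.Bundles using (Inverse)
open import Function.Definitions using (Injective)
open import Relation.Binary.Bundles using (Setoid)
open import Relation.Binary.Core using (Rel)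
open import Relation.Binary.Definitions using (Symmetric; _Respectsʳ_)
open import Relation.Binary.PropositionalEquality using (_≡_; setoid)
open import Relation.Nullary.Negation using (¬_)

private
  variable
    c ℓ v e : Level

IsPrimePower : ℕ → Set
IsPrimePower q = ∃[ p ] ∃[ k ] (Prime p × 1 ≤ k × q ≡ p ^ k)

record FiniteField (c ℓ : Level) (q : ℕ) : Set (lsuc (c ⊔ ℓ)) where
  field
    commutativeRing : CommutativeRing c ℓ

  open CommutativeRing commutativeRing public
    hiding (zero) renaming (setoid to ≈-setoid)
  open AlgebraDefinitions _≈_ using (Invertible)

  field
    1≉0     : 1# ≉ 0#
    inverse : ∀ x → x ≉ 0# → Invertible 1# _*_ x
    order   : Inverse (setoid (Fin q)) ≈-setoid

-- Vertices are taken up to the equality of their setoid, so adjacency has to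
-- respect it, and "no loops" means that adjacent vertices are not equal there.
record SimpleGraph (v ℓ e : Level) : Set (lsuc (v ⊔ ℓ ⊔ e)) where
  field
    vertices : Setoid v ℓ

  open Setoid vertices public using (_≈_) renaming (Carrier to Vertex)

  field
    Adj      : Rel Vertex e
    adj-resp : Adj Respectsʳ _≈_
    adj-sym  : Symmetric Adj
    loopless : ∀ {x y} → Adj x y → ¬ (x ≈ y)

module _ (G : SimpleGraph v ℓ e) where
  open SimpleGraph G

  record Cycle (k : ℕ) : Set (v ⊔ ℓ ⊔ e) where
    field
      length≥3 : 3 ≤ k
      vertex   : Fin k → Vertex
      distinct : Injective _≡_ _≈_ vertex
      steps    : ∀ i j → toℕ j ≡ suc (toℕ i) → Adj (vertex i) (vertex j)
      closes   : ∀ i j → suc (toℕ i) ≡ k → toℕ j ≡ 0 →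
                 Adj (vertex i) (vertex j)

  IsGirth : ℕ → Set (v ⊔ ℓ ⊔ e)
  IsGirth g = Cycle g × (∀ k → Cycle k → g ≤ k)

module _ {q : ℕ} (F : FiniteField c ℓ q) where
  open FiniteField F
  open VecEq ≈-setoid using (_≋_; ≋-setoid; ≋-refl)

  infix 9 _!_

  -- x ! j is the coordinate x_j, counted from 1.  Out of range (j = 0 or j > n)
  -- it is 0#; Incident below only uses coordinates in range.
  _!_ : ∀ {n} → Vector Carrier n → ℕ → Carrier
  _!_ {zero}  x _             = 0#
  _!_ {suc n} x 0             = 0#
  _!_ {suc n} x 1             = x zero
  _!_ {suc n} x (suc (suc j)) = tail x ! suc j

  !-cong : ∀ {n} {x y : Vector Carrier n} → x ≋ y → ∀ j → x ! j ≈ y ! j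
  !-cong {zero}  x≋y _             = refl
  !-cong {suc n} x≋y 0             = refl
  !-cong {suc n} x≋y 1             = x≋y zero
  !-cong {suc n} x≋y (suc (suc j)) = !-cong (λ i → x≋y (suc i)) (suc j)

  record Incident (n : ℕ) (p l : Vector Carrier n) : Set ℓ where
    field
      eq₂  : 2 ≤ n → p ! 2 + l ! 2 ≈ p ! 1 * l ! 1
      eq₃  : 3 ≤ n → p ! 3 + l ! 3 ≈ p ! 1 * l ! 2
      eq₀₁ : ∀ j → 4 ≤ j → j ≤ n → j % 4 ≡ 0 ⊎ j % 4 ≡ 1 →
             p ! j + l ! j ≈ p ! (j ∸ 2) * l ! 1
      eq₂₃ : ∀ j → 4 ≤ j → j ≤ n → j % 4 ≡ 2 ⊎ j % 4 ≡ 3 →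
             p ! j + l ! j ≈ p ! 1 * l ! (j ∸ 2)

  Incident-resp : ∀ {n} {p p′ l l′ : Vector Carrier n} →
                  p ≋ p′ → l ≋ l′ → Incident n p l → Incident n p′ l′
  Incident-resp {p = p} {p′} {l} {l′} p≋p′ l≋l′ inc = record
    { eq₂  = λ 2≤n → transport 2 1 1 (eq₂ 2≤n)
    ; eq₃  = λ 3≤n → transport 3 1 2 (eq₃ 3≤n)
    ; eq₀₁ = λ j 4≤j j≤n r → transport j (j ∸ 2) 1 (eq₀₁ j 4≤j j≤n r)
    ; eq₂₃ = λ j 4≤j j≤n r → transport j 1 (j ∸ 2) (eq₂₃ j 4≤j j≤n r)
    }
    where
    open Incident inc
    transport : ∀ j a b → p ! j + l ! j ≈ p ! a * l ! b →
                p′ ! j + l′ ! j ≈ p′ ! a * l′ ! b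
    transport j a b eq =
      trans (sym (+-cong (!-cong p≋p′ j) (!-cong l≋l′ j)))
            (trans eq (*-cong (!-cong p≋p′ a) (!-cong l≋l′ b)))

  -- inj₁ marks the points and inj₂ the lines.
  DVertex : ℕ → Set c
  DVertex n = Vector Carrier n ⊎ Vector Carrier n

  DAdj : (n : ℕ) → Rel (DVertex n) ℓ
  DAdj n (inj₁ p) (inj₂ l) = Incident n p l
  DAdj n (inj₂ l) (inj₁ p) = Incident n p l
  DAdj n (inj₁ _) (inj₁ _) = ⊥
  DAdj n (inj₂ _) (inj₂ _) = ⊥

  D : ℕ → SimpleGraph c (c ⊔ ℓ) ℓ
  D n = record
    { vertices = DSetoid
    ; Adj      = DAdj n
    ; adj-resp = λ {x} {y} {z} → resp x y z
    ; adj-sym  = λ {x} {y} → symm x y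
    ; loopless = λ {x} {y} → irrefl x y
    }
    where
    DSetoid : Setoid c (c ⊔ ℓ)
    DSetoid = Sum.⊎-setoid (≋-setoid n) (≋-setoid n)

    open Setoid DSetoid using () renaming (_≈_ to _≈ᵥ_)

    resp : ∀ x y z → y ≈ᵥ z → DAdj n x y → DAdj n x z
    resp (inj₁ p) (inj₂ l) (inj₂ l′) (Sum.inj₂ l≋l′) inc =
      Incident-resp ≋-refl l≋l′ inc
    resp (inj₂ l) (inj₁ p) (inj₁ p′) (Sum.inj₁ p≋p′) inc =
      Incident-resp p≋p′ ≋-refl inc

    symm : ∀ x y → DAdj n x y → DAdj n y x
    symm (inj₁ _) (inj₂ _) inc = inc
    symm (inj₂ _) (inj₁ _) inc = inc

    irrefl : ∀ x y → DAdj n x y → ¬ (x ≈ᵥ y)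
    irrefl (inj₁ _) (inj₂ _) _ ()
    irrefl (inj₂ _) (inj₁ _) _ ()

{-# OPTIONS --safe #-}

-- Each vertex v carries a sequence chain v of 1 and about half of its
-- coordinates, such that along a path x, y, z
--   chain z (j + 1) = chain x (j + 1) + (z₁ - x₁) · chain y j.
-- Hence chain (w s), for a walk w, is an alternating convolution of the chains
-- of w 0 and w 1 with coefficients that obey the same recursion: a continuant in
-- the increments z₁ - x₁, of degree s - 1 with leading coefficient their product,
-- which is nonzero when w does not backtrack.  In a closed walk of length 2m from
-- a point, the vertex w (m + 1) is also reached backwards from the edge
-- {w 0, w 1}, one step earlier and so with a continuant of smaller degree.  If
-- 2m ≤ n + 3 the coordinates of index at most n determine both continuants up to
-- degree m, a contradiction.  A cycle exists by pigeonhole, because a neighbour of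
-- a vertex can be prescribed by its first coordinate.
module Submission where

open import Defs
open import Level using (Level; _⊔_)
open import Algebra.Bundles using (CommutativeRing)
import Algebra.Properties.CommutativeSemigroup as CommutativeSemigroupProperties
import Algebra.Properties.Ring as RingProperties
open import Data.Bool.Base using (Bool; true; false; not; if_then_else_)
open import Data.Bool.Properties using (not-involutive; not-¬)
open import Data.Empty using (⊥)
open import Data.Empty.Polymorphic using (⊥-elim)
open import Data.Fin.Base using (Fin; toℕ; funToFin; finToFun; splitAt; join)
open import Data.Fin.Properties as Fin using (toℕ<n; toℕ-fromℕ<; toℕ-injective; pigeonhole; finToFun-funToFin; splitAt-join; all?; any?)
open import Data.Nat.Base as ℕ using (ℕ; zero; suc; _≤_; _<_; s≤s; s≤s⁻¹; z≤n; z<s; _%_; _/_; _^_; _<ᵇ_; NonZero)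
open import Data.Nat.Divisibility using (_∣_; _∤_; divides; ∣m+n∣m⇒∣n; ∣⇒≤)
open import Data.Nat.DivMod using (_mod_; m≡m%n+[m/n]*n; m%n<n; m<n⇒m%n≡m; n%n≡0; [m+n]%n≡m%n; %-distribˡ-+)
open import Data.Nat.Induction using (<-rec)
open import Data.Nat.Properties as ℕ using (≤-refl; ≤-trans; ≤-reflexive; <⇒≤; n≤1+n; m≤n+m; m≤n⇒m≤1+n; m≤n⇒m<n∨m≡n; +-monoʳ-≤; +-cancelˡ-≤; _≤?_; anyUpTo?; allUpTo?)
open import Data.Product.Base using (∃; ∃-syntax; _×_; _,_; proj₂)
import Data.Sum.Base as ⊎
open ⊎ using (_⊎_; inj₁; inj₂; [_,_]′)
import Data.Sum.Relation.Binary.Pointwise as Sum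
open import Data.Unit.Base using (⊤; tt)
open import Data.Vec.Functional using (Vector)
import Data.Vec.Functional.Relation.Binary.Equality.Setoid as VecEq
import Data.Vec.Functional.Relation.Binary.Pointwise.Properties as Pointwise
open import Function.Base using (_∘_; id)
open import Function.Bundles using (Inverse)
open import Relation.Binary.Bundles using (Setoid)
open import Relation.Binary.Definitions using (Decidable; tri<; tri≈; tri>)
open import Relation.Binary.PropositionalEquality as ≡ using (_≡_; _≢_; subst; cong)
import Relation.Binary.Reasoning.Setoid as SetoidReasoning
open import Relation.Nullary.Decidable using (Dec; yes; no; map′; _×-dec_; _→-dec_)
open import Relation.Nullary.Negation using (¬_; contradiction)

private
  variable
    c ℓ v e : Level

-- Residues modulo the length of a cycle.

module _ {k : ℕ} .{{_ : NonZero k}} where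
  open import Data.Nat.Base using (_+_; _*_)
  open import Data.Nat.Properties using (+-assoc; +-comm; +-cancelˡ-≡; <⇒≱)
  open ≡ using (refl; sym; trans; module ≡-Reasoning)

  toℕ-mod : ∀ i → toℕ (i mod k) ≡ i % k
  toℕ-mod i = toℕ-fromℕ< (m%n<n i k)

  mod-cong : ∀ {i j} → i % k ≡ j % k → i mod k ≡ j mod k
  mod-cong {i} {j} eq =
    toℕ-injective (trans (toℕ-mod i) (trans eq (sym (toℕ-mod j))))

  suc-% : 1 < k → ∀ i → suc i % k ≡ suc (i % k) % k
  suc-% 1<k i = trans (%-distribˡ-+ 1 i k) (cong (λ r → (r + i % k) % k) (m<n⇒m%n≡m 1<k))

  %-≢-2+ : 2 < k → ∀ i → ¬ (i % k ≡ (2 + i) % k)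
  %-≢-2+ 2<k i eq = <⇒≱ 2<k (∣⇒≤ (∣m+n∣m⇒∣n (divides b a*k+2≡b*k) (divides a refl)))
    where
    open ≡-Reasoning
    a = i / k
    b = (2 + i) / k
    r = i % k
    a*k+2≡b*k : a * k + 2 ≡ b * k
    a*k+2≡b*k = +-cancelˡ-≡ r _ _ (begin
      r + (a * k + 2)           ≡⟨ +-assoc r (a * k) 2 ⟨
      r + a * k + 2             ≡⟨ cong (_+ 2) (m≡m%n+[m/n]*n i k) ⟨
      i + 2                     ≡⟨ +-comm i 2 ⟩
      2 + i                     ≡⟨ m≡m%n+[m/n]*n (2 + i) k ⟩
      (2 + i) % k + b * k       ≡⟨ cong (_+ b * k) eq ⟨
      r + b * k                 ∎)

-- Closed walks, cycles and girth in an arbitrary graph.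

module _ (G : SimpleGraph v ℓ e) where
  open SimpleGraph G
  open import Data.Nat.Base using (_+_; _*_; _∸_)
  open import Data.Nat.Properties using (+-identityʳ; +-assoc; +-comm; +-suc; ≮⇒≥; n<1+n; m+[n∸m]≡n; m<n⇒0<n∸m; +-monoʳ-<; <-cmp)
  open ≡ using (refl; sym; trans; module ≡-Reasoning)
  open Setoid vertices using () renaming (refl to ≈-refl; sym to ≈-sym; trans to ≈-trans)

  record NonBacktrackingWalk : Set (v ⊔ ℓ ⊔ e) where
    field
      at          : ℕ → Vertex
      adjacent    : ∀ i → Adj (at i) (at (suc i))
      noBacktrack : ∀ i → ¬ at i ≈ at (2 + i)

  Adj-resp : ∀ {x x′ y y′} → x ≈ x′ → y ≈ y′ → Adj x y → Adj x′ y′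
  Adj-resp x≈x′ y≈y′ = adj-resp y≈y′ ∘ adj-sym ∘ adj-resp x≈x′ ∘ adj-sym

  cycle-resp : ∀ {k} (C : Cycle G k) {f : Fin k → Vertex} →
               (∀ i → Cycle.vertex C i ≈ f i) → Cycle G k
  cycle-resp C {f} C≈f = record
    { length≥3 = length≥3
    ; vertex   = f
    ; distinct = λ {i} {j} fi≈fj →
        distinct (≈-trans (C≈f i) (≈-trans fi≈fj (≈-sym (C≈f j))))
    ; steps    = λ i j eq → Adj-resp (C≈f i) (C≈f j) (steps i j eq)
    ; closes   = λ i j eq eq′ → Adj-resp (C≈f i) (C≈f j) (closes i j eq eq′)
    }
    where open Cycle C

  open NonBacktrackingWalk

  shift : NonBacktrackingWalk → NonBacktrackingWalk
  shift w = record
    { at          = at w ∘ suc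
    ; adjacent    = adjacent w ∘ suc
    ; noBacktrack = noBacktrack w ∘ suc
    }

  -- Propositional equality instead of `≈`, so that `cong` and `subst` can move vertices around; the
  -- walk read off a cycle satisfies it on the nose.
  Periodic : NonBacktrackingWalk → ℕ → Set v
  Periodic w k = ∀ i → at w (i + k) ≡ at w i

  periodic-* : ∀ w {k} → Periodic w k → ∀ r i → at w (i + r * k) ≡ at w i
  periodic-* w {k} period zero    i = cong (at w) (+-identityʳ i)
  periodic-* w {k} period (suc r) i = trans
    (cong (at w) (sym (+-assoc i k (r * k))))
    (trans (periodic-* w period r (i + k)) (period i))

  -- Modulo the period suc k, a step by k is a step backwards.
  reverse : ∀ w k → Periodic w (suc k) → NonBacktrackingWalk
  reverse w k period = record
    { at          = λ i → at w (suc (i * k))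
    ; adjacent    = λ i → subst (λ x → Adj x (at w (suc (k + i * k)))) (back (i * k))
                            (adj-sym (adjacent w _))
    ; noBacktrack = λ i eq → noBacktrack w (suc (k + (k + i * k)))
        (subst (at w (suc (k + (k + i * k))) ≈_) (sym (back² (i * k))) (≈-sym eq))
    }
    where
    back : ∀ j → at w (suc (suc (k + j))) ≡ at w (suc j)
    back j = trans (cong (at w ∘ suc) (+-comm (suc k) j)) (period (suc j))

    back² : ∀ j → at w (3 + (k + (k + j))) ≡ at w (suc j)
    back² j = trans (cong (at w ∘ suc ∘ suc) (sym (+-suc k (k + j))))
      (trans (back (suc (k + j))) (back j))

  -- The walk runs round the cycle forever; backtracking would identify the positions `i` and
  -- `2 + i` modulo `k`, which `length≥3` forbids.
  cycle⇒walk : ∀ {k} → Cycle G k →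
    ∃[ w ] Periodic w k
  cycle⇒walk {k@(suc (suc (suc _)))} C = record
    { at          = λ i → vertex (i mod k)
    ; adjacent    = next
    ; noBacktrack = λ i eq → %-≢-2+ length≥3 i
        (trans (sym (toℕ-mod i)) (trans (cong toℕ (distinct eq)) (toℕ-mod (2 + i))))
    } , λ i → cong vertex (mod-cong {i = i + k} {i} ([m+n]%n≡m%n i k))
    where
    open Cycle C
    next : ∀ i → Adj (vertex (i mod k)) (vertex (suc i mod k))
    next i with m≤n⇒m<n∨m≡n (m%n<n i k)
    ... | inj₁ 1+r<k = steps _ _ (begin
      toℕ (suc i mod k)    ≡⟨ toℕ-mod (suc i) ⟩
      suc i % k            ≡⟨ suc-% (s≤s z<s) i ⟩
      suc (i % k) % k      ≡⟨ m<n⇒m%n≡m 1+r<k ⟩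
      suc (i % k)          ≡⟨ cong suc (toℕ-mod i) ⟨
      suc (toℕ (i mod k))  ∎)
      where open ≡-Reasoning
    ... | inj₂ 1+r≡k = closes _ _ (trans (cong suc (toℕ-mod i)) 1+r≡k) (begin
      toℕ (suc i mod k)    ≡⟨ toℕ-mod (suc i) ⟩
      suc i % k            ≡⟨ suc-% (s≤s z<s) i ⟩
      suc (i % k) % k      ≡⟨ cong (_% k) 1+r≡k ⟩
      k % k                ≡⟨ n%n≡0 k ⟩
      0                    ∎)
      where open ≡-Reasoning
  cycle⇒walk {0} C = contradiction (Cycle.length≥3 C) λ ()
  cycle⇒walk {1} C = contradiction (Cycle.length≥3 C) λ { (s≤s ()) }
  cycle⇒walk {2} C = contradiction (Cycle.length≥3 C) λ { (s≤s (s≤s ())) }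

  module _ {N : ℕ} (enum : Fin N → Vertex) (index : Vertex → Fin N)
           (enum-index : ∀ x → enum (index x) ≈ x)
           (_≈?_ : Decidable _≈_) (Adj? : Decidable Adj) where

    IsCycle : ∀ {k} → (Fin k → Vertex) → Set (ℓ ⊔ e)
    IsCycle {k} f = 3 ≤ k
      × (∀ i j → f i ≈ f j → i ≡ j)
      × (∀ i j → toℕ j ≡ suc (toℕ i) → Adj (f i) (f j))
      × (∀ i j → suc (toℕ i) ≡ k → toℕ j ≡ 0 → Adj (f i) (f j))

    isCycle? : ∀ {k} (f : Fin k → Vertex) → Dec (IsCycle f)
    isCycle? {k} f = (3 ≤? k)
      ×-dec all? (λ i → all? λ j → (f i ≈? f j) →-dec (i Fin.≟ j))
      ×-dec all? (λ i → all? λ j → (toℕ j ℕ.≟ suc (toℕ i)) →-dec Adj? (f i) (f j))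
      ×-dec all? (λ i → all? λ j → (suc (toℕ i) ℕ.≟ k) →-dec
                                   ((toℕ j ℕ.≟ 0) →-dec Adj? (f i) (f j)))

    -- By `cycle-resp` only cycles through the representatives given by `enum` matter, and these are
    -- coded by a finite set, so exhaustive search decides.
    cycle? : ∀ k → Dec (Cycle G k)
    cycle? k = map′ to from (any? λ c → isCycle? (enum ∘ finToFun {N} {k} c))
      where
      to : ∃ (λ c → IsCycle (enum ∘ finToFun {N} {k} c)) → Cycle G k
      to (c , 3≤k , inj , st , cl) = record
        { length≥3 = 3≤k ; vertex = enum ∘ finToFun c
        ; distinct = λ {i} {j} → inj i j ; steps = st ; closes = cl }

      from : Cycle G k → ∃ (λ c → IsCycle (enum ∘ finToFun {N} {k} c))
      from C = funToFin (index ∘ vertex) , length≥3 , (λ _ _ → distinct) , steps , closes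
        where
        open Cycle (cycle-resp C {enum ∘ finToFun (funToFin (index ∘ Cycle.vertex C))} λ i → ≈-trans
          (≈-sym (enum-index _))
          (Setoid.reflexive vertices (cong enum (sym (finToFun-funToFin (index ∘ Cycle.vertex C) i)))))
          hiding (vertex)
        open Cycle C using (vertex)

    -- Descent: as long as the search finds a shorter cycle, pass to it.
    cycle⇒girth : ∀ {k} → Cycle G k → ∃ (IsGirth G)
    cycle⇒girth {k} = <-rec (λ k → Cycle G k → ∃ (IsGirth G)) shorten k
      where
      shorten : ∀ k → (∀ {j} → j < k → Cycle G j → ∃ (IsGirth G)) →
                Cycle G k → ∃ (IsGirth G)
      shorten k rec C with anyUpTo? cycle? k
      ... | yes (j , j<k , C′) = rec j<k C′
      ... | no  ¬shorter       =
        k , C , λ j C′ → ≮⇒≥ λ j<k → ¬shorter (j , j<k , C′)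

    walk⇒cycle : NonBacktrackingWalk → ∃ (Cycle G)
    -- Among `N + 1` visits two share a code. Descending to the earliest time `j` at which the walk
    -- returns to a visited vertex `at w i` makes the stretch from `i` to `j - 1` a cycle.
    walk⇒cycle w with pigeonhole (n<1+n N) (index ∘ at w ∘ toℕ)
    ... | i₀ , j₀ , i₀<j₀ , eq = <-rec (λ j → Returns j → ∃ (Cycle G)) firstReturn (toℕ j₀)
      (toℕ i₀ , i₀<j₀ , ≈-trans (≈-sym (enum-index _))
        (≈-trans (Setoid.reflexive vertices (cong enum eq)) (enum-index _)))
      where
      Returns : ℕ → Set ℓ
      Returns j = ∃[ i ] (i < j × at w i ≈ at w j)

      returns? : ∀ j → Dec (Returns j)
      returns? j = anyUpTo? (λ i → at w i ≈? at w j) j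

      firstReturn : ∀ j → (∀ {j′} → j′ < j → Returns j′ → ∃ (Cycle G)) →
                    Returns j → ∃ (Cycle G)
      firstReturn j rec (i , i<j , i≈j) with anyUpTo? returns? j
      ... | yes (j′ , j′<j , r) = rec j′<j r
      ... | no  ¬earlier        = k , record
        { length≥3 = length≥3 i i+k≡j i≈j k>0
        ; vertex   = λ x → at w (i + toℕ x)
        ; distinct = λ {x} {y} → injective x y
        ; steps    = λ x y eq → subst (λ z → Adj (at w (i + toℕ x)) (at w z))
            (trans (sym (+-suc i (toℕ x))) (cong (i +_) (sym eq))) (adjacent w (i + toℕ x))
        ; closes   = λ x y eq eq′ → adj-resp
            (≈-trans (Setoid.reflexive vertices (cong (at w)
                (trans (sym (+-suc i (toℕ x))) (trans (cong (i +_) eq) i+k≡j))))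
              (≈-trans (≈-sym i≈j)
                (Setoid.reflexive vertices (cong (at w)
                  (trans (sym (+-identityʳ i)) (cong (i +_) (sym eq′)))))))
            (adjacent w (i + toℕ x))
        }
        where
        k = j ∸ i
        i+k≡j : i + k ≡ j
        i+k≡j = m+[n∸m]≡n (<⇒≤ i<j)
        k>0 : 0 < k
        k>0 = m<n⇒0<n∸m i<j

        -- A return after one step would be a loop, after two steps a backtrack.
        length≥3 : ∀ i {k} → i + k ≡ j → at w i ≈ at w j → 0 < k → 3 ≤ k
        length≥3 i {1} eq i≈j _ = contradiction
          (≈-trans i≈j (Setoid.reflexive vertices (cong (at w) (trans (sym eq) (+-comm i 1)))))
          (loopless (adjacent w i))
        length≥3 i {2} eq i≈j _ = contradiction
          (≈-trans i≈j (Setoid.reflexive vertices (cong (at w) (trans (sym eq) (+-comm i 2)))))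
          (noBacktrack w i)
        length≥3 i {suc (suc (suc _))} _ _ _ = s≤s (s≤s (s≤s z≤n))

        i+x<j : ∀ (x : Fin k) → i + toℕ x < j
        i+x<j x = subst (i + toℕ x <_) i+k≡j (+-monoʳ-< i (toℕ<n x))

        injective : ∀ (x y : Fin k) → at w (i + toℕ x) ≈ at w (i + toℕ y) → x ≡ y
        injective x y eq with <-cmp (toℕ x) (toℕ y)
        ... | tri< x<y _ _ = contradiction
          (i + toℕ y , i+x<j y , i + toℕ x , +-monoʳ-< i x<y , eq) ¬earlier
        ... | tri≈ _ x≡y _ = toℕ-injective x≡y
        ... | tri> _ _ y<x = contradiction
          (i + toℕ x , i+x<j x , i + toℕ y , +-monoʳ-< i y<x , ≈-sym eq) ¬earlier

-- Coordinates selected by the chains, and the factors in their equations.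

alternate : ∀ {a} {A : Set a} → A → A → ℕ → A
alternate x y zero    = x
alternate x y (suc s) = alternate y x s

alternate-elim : ∀ {a p} {A : Set a} (P : A → Set p) x y → P x → P y →
                 ∀ s → P (alternate x y s)
alternate-elim P x y px py zero    = px
alternate-elim P x y px py (suc s) = alternate-elim P y x py px s

-- 0, 1, 4, 5, 8, 9, …
jump : ℕ → ℕ
jump 0             = 0
jump 1             = 1
jump (suc (suc j)) = 4 ℕ.+ jump j

-- After the first coordinate, a point (`true`) contributes the coordinates whose equation contains
-- `p₁`, a line those whose equation contains `ℓ₁`.
index : Bool → ℕ → ℕ
index _     0             = 1
index true  (suc j)       = 2 ℕ.+ jump j
index false 1             = 2
index false (suc (suc j)) = 4 ℕ.+ jump j

-- Incidence reads p₂₊ᵢ + ℓ₂₊ᵢ = p_a ℓ_b with a = pointFactor i, b = lineFactor i.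
pointFactor lineFactor : ℕ → ℕ
pointFactor (suc (suc i)) = if i % 4 <ᵇ 2 then 2 ℕ.+ i else 1
pointFactor _             = 1
lineFactor 0              = 1
lineFactor 1              = 2
lineFactor (suc (suc i))  = if i % 4 <ᵇ 2 then 1 else 2 ℕ.+ i

if-≤ : ∀ b {x y z} → x ≤ z → y ≤ z → (if b then x else y) ≤ z
if-≤ true  p q = p
if-≤ false p q = q

-- Makes the incidence equations triangular: the right side of the equation for coordinate `2 + i`
-- refers to earlier coordinates only.
pointFactor≤ : ∀ i → pointFactor i ≤ suc i
pointFactor≤ 0             = ≤-refl
pointFactor≤ 1             = s≤s z≤n
pointFactor≤ (suc (suc i)) = if-≤ (i % 4 <ᵇ 2) (n≤1+n _) (s≤s z≤n)

lineFactor≤ : ∀ i → lineFactor i ≤ suc i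
lineFactor≤ 0             = ≤-refl
lineFactor≤ 1             = ≤-refl
lineFactor≤ (suc (suc i)) = if-≤ (i % 4 <ᵇ 2) (s≤s z≤n) (n≤1+n _)

4+-% : ∀ i → (4 ℕ.+ i) % 4 ≡ i % 4
4+-% i = ≡.trans (cong (_% 4) (ℕ.+-comm 4 i)) ([m+n]%n≡m%n i 4)

jump-%4<2 : ∀ j → (jump j % 4 <ᵇ 2) ≡ true
jump-%4<2 0             = ≡.refl
jump-%4<2 1             = ≡.refl
jump-%4<2 (suc (suc j)) =
  ≡.trans (cong (_<ᵇ 2) (4+-% (jump j))) (jump-%4<2 j)

2+jump-%4≥2 : ∀ j → ((2 ℕ.+ jump j) % 4 <ᵇ 2) ≡ false
2+jump-%4≥2 0             = ≡.refl
2+jump-%4≥2 1             = ≡.refl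
2+jump-%4≥2 (suc (suc j)) =
  ≡.trans (cong (_<ᵇ 2) (4+-% (2 ℕ.+ jump j))) (2+jump-%4≥2 j)

-- Together with `lineFactor-jump`: an equation of the point chain multiplies `p₁` by the line-chain
-- entry one place earlier. The two lemmas on `2 + jump j` are the mirror image.
pointFactor-jump : ∀ j → pointFactor (jump j) ≡ 1
pointFactor-jump 0             = ≡.refl
pointFactor-jump 1             = ≡.refl
pointFactor-jump (suc (suc j)) rewrite 2+jump-%4≥2 j = ≡.refl

lineFactor-jump : ∀ j → lineFactor (jump j) ≡ index false j
lineFactor-jump 0             = ≡.refl
lineFactor-jump 1             = ≡.refl
lineFactor-jump (suc (suc j)) rewrite 2+jump-%4≥2 j = ≡.refl

pointFactor-2+jump : ∀ j → pointFactor (2 ℕ.+ jump j) ≡ index true (suc j)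
pointFactor-2+jump j rewrite jump-%4<2 j = ≡.refl

lineFactor-2+jump : ∀ j → lineFactor (2 ℕ.+ jump j) ≡ 1
lineFactor-2+jump j rewrite jump-%4<2 j = ≡.refl

jump-mono : ∀ j → jump j ≤ jump (suc j)
jump-mono 0             = z≤n
jump-mono 1             = s≤s z≤n
jump-mono (suc (suc j)) = +-monoʳ-≤ 4 (jump-mono j)

index-mono : ∀ b j → index b j ≤ index b (suc j)
index-mono true  0             = s≤s z≤n
index-mono true  (suc j)       = +-monoʳ-≤ 2 (jump-mono j)
index-mono false 0             = s≤s z≤n
index-mono false 1             = s≤s (s≤s z≤n)
index-mono false (suc (suc j)) = +-monoʳ-≤ 4 (jump-mono j)

-- If a chain entry of a vertex is in range, so is the preceding entry of each neighbour.
index-not : ∀ b j → index (not b) j ≤ index b (suc j)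
index-not true  0             = s≤s z≤n
index-not true  1             = s≤s (s≤s z≤n)
index-not true  (suc (suc j)) = m≤n+m _ 2
index-not false 0             = s≤s z≤n
index-not false (suc j)       = m≤n+m _ 2

-- With `M = 2 + m`, a closed walk of length `2M` needs the chain entries up to `M`, hence
-- coordinates up to `index _ (M - 1)`. For `M = 2` the length bound gives only `1 ≤ n`, so `2 ≤ n`
-- is used instead.
index-bound : ∀ {n} m → 2 ≤ n → (2 ℕ.+ m) ℕ.+ (2 ℕ.+ m) ≤ 3 ℕ.+ n →
              index (alternate false true m) (1 ℕ.+ m) ≤ n
index-bound 0 2≤n _ = 2≤n
index-bound 1 _   b = +-cancelˡ-≤ 3 _ _ b
index-bound (suc (suc m)) _ b = ≤-trans (sharp m)
  (+-cancelˡ-≤ 3 _ _ (≤-trans (≤-reflexive (≡.sym (doubled m))) b))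
  where
  double : ∀ m → (2 ℕ.+ m) ℕ.+ (2 ℕ.+ m) ≡ 4 ℕ.+ (m ℕ.+ m)
  double m = cong (2 ℕ.+_) (≡.trans (ℕ.+-suc m (suc m)) (cong suc (ℕ.+-suc m m)))

  doubled : ∀ m → (4 ℕ.+ m) ℕ.+ (4 ℕ.+ m) ≡ 3 ℕ.+ (5 ℕ.+ (m ℕ.+ m))
  doubled m = ≡.trans (double (2 ℕ.+ m)) (cong (4 ℕ.+_) (double m))

  index-4+ : ∀ b m → index b (5 ℕ.+ m) ≡ 4 ℕ.+ index b (3 ℕ.+ m)
  index-4+ true  m = ≡.refl
  index-4+ false m = ≡.refl

  -- `index` gains 4 in two steps, so `m = 0` and `m = 1` suffice, both with equality. The side
  -- matters: `index true 3` is 6, above the bound 5, and hence closed walks are started at a point.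
  sharp : ∀ m → index (alternate false true m) (3 ℕ.+ m) ≤ 5 ℕ.+ (m ℕ.+ m)
  sharp 0             = ≤-refl
  sharp 1             = ≤-refl
  sharp (suc (suc m)) = ≤-trans
    (≤-reflexive (index-4+ (alternate false true m) m))
    (≤-trans (+-monoʳ-≤ 4 (sharp m)) (≤-reflexive (cong (5 ℕ.+_) (≡.sym (double m)))))

-- Convolutions and continuants over a commutative ring.

module Convolution (R : CommutativeRing c ℓ) where
  open CommutativeRing R hiding (zero)
  open RingProperties ring
  open SetoidReasoning setoid
  private module + = CommutativeSemigroupProperties +-commutativeSemigroup

  -- Subtracting the two equations eliminates `b`, a coordinate of the common neighbour that its own
  -- chain need not contain.
  step-solve : ∀ {a a′ b x x′ y} → a + b ≈ x * y → a′ + b ≈ x′ * y →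
               a′ ≈ a + (x′ - x) * y
  step-solve {a} {a′} {b} {x} {x′} {y} eq eq′ = +-cancelʳ b _ _ (begin
    a′ + b                    ≈⟨ eq′ ⟩
    x′ * y                    ≈⟨ *-congʳ (//-rightDividesˡ x x′) ⟨
    (x′ - x + x) * y          ≈⟨ distribʳ y _ _ ⟩
    (x′ - x) * y + x * y      ≈⟨ +-comm _ _ ⟩
    x * y + (x′ - x) * y      ≈⟨ +-congʳ eq ⟨
    a + b + (x′ - x) * y      ≈⟨ +.xy∙z≈xz∙y a b _ ⟩
    a + (x′ - x) * y + b      ∎)

  -- This is `c₀ X_j + c₁ Y_{j-1} + c₂ X_{j-2} + …`; the two sequences take turns because points and
  -- lines do so along a walk.
  convolve : (ℕ → Carrier) → (ℕ → Carrier) → (ℕ → Carrier) → ℕ → Carrier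
  convolve c X Y zero    = c 0 * X 0
  convolve c X Y (suc j) = c 0 * X (suc j) + convolve (c ∘ suc) Y X j

  convolve-linear : ∀ {c d e u} X Y → (∀ i → e i ≈ c i + u * d i) → ∀ j →
    convolve e X Y j ≈ convolve c X Y j + u * convolve d X Y j
  convolve-linear {c} {d} {e} {u} X Y eq = go
    where
    term : ∀ x → e 0 * x ≈ c 0 * x + u * (d 0 * x)
    term x = begin
      e 0 * x                  ≈⟨ *-congʳ (eq 0) ⟩
      (c 0 + u * d 0) * x      ≈⟨ distribʳ x _ _ ⟩
      c 0 * x + u * d 0 * x    ≈⟨ +-congˡ (*-assoc u _ x) ⟩
      c 0 * x + u * (d 0 * x)  ∎
    go : ∀ j → convolve e X Y j ≈ convolve c X Y j + u * convolve d X Y j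
    go zero    = term (X 0)
    go (suc j) = begin
      e 0 * X (suc j) + convolve (e ∘ suc) Y X j
        ≈⟨ +-cong (term (X (suc j))) (convolve-linear Y X (eq ∘ suc) j) ⟩
      c 0 * X (suc j) + u * (d 0 * X (suc j)) +
        (convolve (c ∘ suc) Y X j + u * convolve (d ∘ suc) Y X j)
        ≈⟨ +.interchange _ _ _ _ ⟩
      convolve c X Y (suc j) +
        (u * (d 0 * X (suc j)) + u * convolve (d ∘ suc) Y X j)
        ≈⟨ +-congˡ (distribˡ u _ _) ⟨
      convolve c X Y (suc j) + u * convolve d X Y (suc j)
        ∎

  convolve-zero : ∀ {c} X Y → (∀ i → c i ≈ 0#) → ∀ j → convolve c X Y j ≈ 0#
  convolve-zero X Y c≈0 zero    = trans (*-congʳ (c≈0 0)) (zeroˡ _)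
  convolve-zero X Y c≈0 (suc j) = trans
    (+-cong (trans (*-congʳ (c≈0 0)) (zeroˡ _)) (convolve-zero Y X (c≈0 ∘ suc) j))
    (+-identityˡ 0#)

  convolve-one : ∀ {c} X Y → c 0 ≈ 1# → (∀ i → c (suc i) ≈ 0#) → ∀ j →
                 convolve c X Y j ≈ X j
  convolve-one X Y c₀≈1 c≈0 zero    = trans (*-congʳ c₀≈1) (*-identityˡ _)
  convolve-one X Y c₀≈1 c≈0 (suc j) = trans
    (+-cong (trans (*-congʳ c₀≈1) (*-identityˡ _)) (convolve-zero Y X c≈0 j))
    (+-identityʳ _)

  -- Since `X` and `Y` start with 1, the convolution is unitriangular in its coefficients:
  -- cancelling the equal terms at `c 0` leaves the same problem one place lower, with `X` and `Y`
  -- swapped.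
  convolve-injective : ∀ {c d X Y} → X 0 ≈ 1# → Y 0 ≈ 1# → ∀ j →
    (∀ {i} → i < j → c i ≈ d i) → convolve c X Y j ≈ convolve d X Y j → c j ≈ d j
  convolve-injective {c} {d} {X} {Y} X₀≈1 Y₀≈1 zero below eq = begin
    c 0        ≈⟨ *-identityʳ _ ⟨
    c 0 * 1#   ≈⟨ *-congˡ X₀≈1 ⟨
    c 0 * X 0  ≈⟨ eq ⟩
    d 0 * X 0  ≈⟨ *-congˡ X₀≈1 ⟩
    d 0 * 1#   ≈⟨ *-identityʳ _ ⟩
    d 0        ∎
  convolve-injective {c} {d} {X} X₀≈1 Y₀≈1 (suc j) below eq =
    convolve-injective Y₀≈1 X₀≈1 j (below ∘ s≤s)
      (+-cancelˡ (c 0 * X (suc j)) _ _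
        (trans eq (+-congʳ (*-congʳ (sym (below z<s))))))

  convolve-injective-upTo : ∀ {c d X Y m} → X 0 ≈ 1# → Y 0 ≈ 1# →
    (∀ {j} → j ≤ m → convolve c X Y j ≈ convolve d X Y j) → c m ≈ d m
  convolve-injective-upTo {c} {d} {m = m} X₀≈1 Y₀≈1 eq = upTo (suc m) ≤-refl ≤-refl
    where
    upTo : ∀ k → k ≤ suc m → ∀ {i} → i < k → c i ≈ d i
    upTo (suc k) k<m {i} (s≤s i≤k) with m≤n⇒m<n∨m≡n i≤k
    ... | inj₁ i<k    = upTo k (<⇒≤ k<m) i<k
    ... | inj₂ ≡.refl = convolve-injective X₀≈1 Y₀≈1 k (upTo k (<⇒≤ k<m)) (eq (s≤s⁻¹ k<m))

  -- The coefficient of `t^i` in `K_s`, where `K_0 = K_1 = 1` and `K_{s+2} = K_s + u_s t K_{s+1}`.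
  continuant : (ℕ → Carrier) → ℕ → ℕ → Carrier
  continuant u s             zero    = 1#
  continuant u (suc (suc s)) (suc i) =
    continuant u s (suc i) + u s * continuant u (suc s) i
  continuant u _             (suc i) = 0#

  continuant-degree : ∀ u s {i} → s ≤ suc i → continuant u s (suc i) ≈ 0#
  continuant-degree u 0 _ = refl
  continuant-degree u 1 _ = refl
  continuant-degree u (suc (suc s)) {suc i} (s≤s (s≤s s≤i)) = begin
    continuant u s (2 ℕ.+ i) + u s * continuant u (suc s) (suc i)
      ≈⟨ +-cong (continuant-degree u s (m≤n⇒m≤1+n (m≤n⇒m≤1+n s≤i)))
                (trans (*-congˡ (continuant-degree u (suc s) (s≤s s≤i))) (zeroʳ _)) ⟩
    0# + 0#
      ≈⟨ +-identityˡ 0# ⟩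
    0#
      ∎

  module _ (1≉0 : 1# ≉ 0#)
           (nonZeroProduct : ∀ {x y} → x ≉ 0# → y ≉ 0# → x * y ≉ 0#) where

    -- In the top coefficient the summand from two steps before vanishes by degree, which leaves the
    -- product of `u 0`, ..., `u (s - 1)`.
    continuant-leading : ∀ u → (∀ s → u s ≉ 0#) → ∀ s → continuant u (suc s) s ≉ 0#
    continuant-leading u u≉0 zero    = 1≉0
    continuant-leading u u≉0 (suc s) ≈0 =
      nonZeroProduct (u≉0 s) (continuant-leading u u≉0 s) (begin
        u s * continuant u (suc s) s                           ≈⟨ +-identityˡ _ ⟨
        0# + u s * continuant u (suc s) s
          ≈⟨ +-congʳ (continuant-degree u s (n≤1+n s)) ⟨
        continuant u s (suc s) + u s * continuant u (suc s) s  ≈⟨ ≈0 ⟩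
        0#                                                     ∎)

-- Parity of closed walks in a bipartite graph.

alternates : (f : ℕ → Bool) → (∀ i → f (suc i) ≡ not (f i)) →
             ∀ s → f s ≡ alternate (f 0) (not (f 0)) s
alternates f f-suc zero    = ≡.refl
alternates f f-suc (suc s) = ≡.trans (alternates (f ∘ suc) (f-suc ∘ suc) s)
  (≡.cong₂ (λ x y → alternate x y s) (f-suc 0)
    (≡.trans (cong not (f-suc 0)) (not-involutive (f 0))))

alternates⇒even : ∀ k b → alternate b (not b) k ≡ b → ∃[ m ] k ≡ m ℕ.+ m
alternates⇒even 0 b _ = 0 , ≡.refl
alternates⇒even 1 b b≡not-b = contradiction (≡.sym b≡not-b) (not-¬ ≡.refl)
alternates⇒even (suc (suc k)) b eq with alternates⇒even k b eq
... | m , ≡.refl = suc m , cong suc (≡.sym (ℕ.+-suc m m))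

-- Triangular bilinear systems over a finite field.

module _ {q : ℕ} (F : FiniteField c ℓ q) where
  open FiniteField F
  open RingProperties ring
  open Convolution commutativeRing
  open SetoidReasoning ≈-setoid
  open VecEq ≈-setoid using (_≋_)
  open Inverse order using (to; from; to-cong; strictlyInverseˡ)

  _≈?_ : Decidable _≈_
  x ≈? y = map′
    (λ eq → trans (sym (strictlyInverseˡ x)) (trans (to-cong eq) (strictlyInverseˡ y)))
    (Inverse.from-cong order)
    (from x Fin.≟ from y)

  nonZeroProduct : ∀ {x y} → x ≉ 0# → y ≉ 0# → x * y ≉ 0#
  nonZeroProduct {x} {y} x≉0 y≉0 xy≈0 with inverse x x≉0
  ... | x⁻¹ , x⁻¹*x≈1 , _ = y≉0 (begin
    y              ≈⟨ *-identityˡ y ⟨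
    1# * y         ≈⟨ *-congʳ x⁻¹*x≈1 ⟨
    x⁻¹ * x * y    ≈⟨ *-assoc x⁻¹ x y ⟩
    x⁻¹ * (x * y)  ≈⟨ *-congˡ xy≈0 ⟩
    x⁻¹ * 0#       ≈⟨ zeroʳ x⁻¹ ⟩
    0#             ∎)

  coord : ∀ {n} → Vector Carrier n → ℕ → Carrier
  coord = _!_ F

  coord-tabulate : ∀ {n} (f : ℕ → Carrier) {j} → j < n →
                   coord {n} (f ∘ toℕ) (suc j) ≡ f j
  coord-tabulate {suc n} f {zero}  _         = ≡.refl
  coord-tabulate {suc n} f {suc j} (s≤s j<n) = coord-tabulate (f ∘ suc) j<n

  coord-toℕ : ∀ {n} (x : Vector Carrier n) i → coord x (suc (toℕ i)) ≡ x i
  coord-toℕ {suc n} x Fin.zero    = ≡.refl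
  coord-toℕ {suc n} x (Fin.suc i) = coord-toℕ (x ∘ Fin.suc) i

  coord-0 : ∀ {n} (x : Vector Carrier n) → coord x 0 ≡ 0#
  coord-0 {zero}  x = ≡.refl
  coord-0 {suc n} x = ≡.refl

  coord-injective : ∀ {n} {x y : Vector Carrier n} →
    (∀ j → j ≤ n → coord x j ≈ coord y j) → x ≋ y
  coord-injective {n} {x} {y} eq i = trans (sym (reflexive (coord-toℕ x i)))
    (trans (eq (suc (toℕ i)) (toℕ<n i)) (reflexive (coord-toℕ y i)))

  -- The positions of the factors are parameters: swapping them exchanges points and lines, so that
  -- each argument is made once.
  Bilinear : ∀ {n} (γ δ : ℕ → ℕ) (x y : Vector Carrier n) → Set ℓ
  Bilinear {n} γ δ x y = ∀ i → 2 ℕ.+ i ≤ n →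
    coord x (2 ℕ.+ i) + coord y (2 ℕ.+ i) ≈ coord x (γ i) * coord y (δ i)

  bilinear-sym : ∀ {n γ δ} {x y : Vector Carrier n} →
                 Bilinear γ δ x y → Bilinear δ γ y x
  bilinear-sym eqs i i≤n = trans (+-comm _ _) (trans (eqs i i≤n) (*-comm _ _))

  module _ {n : ℕ} {γ δ : ℕ → ℕ} (γ≤ : ∀ i → γ i ≤ suc i) where

    -- As `γ i ≤ suc i`, each coordinate after the first is forced by `y` and the earlier ones.
    bilinear-unique : {x x′ y : Vector Carrier n} →
      Bilinear γ δ x y → Bilinear γ δ x′ y → coord x 1 ≈ coord x′ 1 → x ≋ x′
    bilinear-unique {x} {x′} {y} eqs eqs′ eq₁ =
      coord-injective λ j j≤n → upTo n ≤-refl j≤n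
      where
      upTo : ∀ k → k ≤ n → ∀ {j} → j ≤ k → coord x j ≈ coord x′ j
      upTo k k≤n {zero} _ = reflexive (≡.trans (coord-0 x) (≡.sym (coord-0 x′)))
      upTo k k≤n {suc zero} _ = eq₁
      upTo (suc k) k≤n {suc (suc i)} (s≤s i<k) = +-cancelʳ _ _ _ (begin
        coord x (2 ℕ.+ i) + coord y (2 ℕ.+ i)
          ≈⟨ eqs i (≤-trans (s≤s i<k) k≤n) ⟩
        coord x (γ i) * coord y (δ i)
          ≈⟨ *-congʳ (upTo k (<⇒≤ k≤n) (≤-trans (γ≤ i) i<k)) ⟩
        coord x′ (γ i) * coord y (δ i)
          ≈⟨ eqs′ i (≤-trans (s≤s i<k) k≤n) ⟨
        coord x′ (2 ℕ.+ i) + coord y (2 ℕ.+ i)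
          ∎)

    module _ (a : Carrier) (y : Vector Carrier n) where

      -- fillTo k j is the j-th coordinate of the solution once j ≤ k.
      fillTo : ℕ → ℕ → Carrier
      fillTo (suc k) 1             = a
      fillTo (suc k) (suc (suc i)) =
        fillTo k (γ i) * coord y (δ i) - coord y (2 ℕ.+ i)
      fillTo _       _             = 0#

      -- The first argument of `fillTo` is fuel, since the recursion through `γ i` is not
      -- structural; this lemma removes it from later equations.
      fillTo-stable : ∀ k k′ {j} → j ≤ k → j ≤ k′ → fillTo k j ≡ fillTo k′ j
      fillTo-stable zero    zero     {zero}        _ _ = ≡.refl
      fillTo-stable zero    (suc k′) {zero}        _ _ = ≡.refl
      fillTo-stable (suc k) zero     {zero}        _ _ = ≡.refl
      fillTo-stable (suc k) (suc k′) {zero}        _ _ = ≡.refl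
      fillTo-stable (suc k) (suc k′) {suc zero}    _ _ = ≡.refl
      fillTo-stable (suc k) (suc k′) {suc (suc i)} (s≤s i<k) (s≤s i<k′) =
        cong (λ z → z * coord y (δ i) - coord y (2 ℕ.+ i))
          (fillTo-stable k k′ (≤-trans (γ≤ i) i<k) (≤-trans (γ≤ i) i<k′))

      fill : Vector Carrier n
      fill = fillTo n ∘ suc ∘ toℕ

      coord-fill : ∀ {j} → j ≤ n → coord fill j ≈ fillTo n j
      coord-fill {suc j} j<n = reflexive (coord-tabulate (fillTo n ∘ suc) j<n)
      coord-fill {zero}  _   = reflexive (≡.trans (coord-0 fill) (fillTo-stable 0 n z≤n z≤n))

      fill-head : 1 ≤ n → coord fill 1 ≈ a
      fill-head 1≤n = trans (coord-fill 1≤n) (reflexive (fillTo-stable n 1 1≤n ≤-refl))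

      fill-bilinear : Bilinear γ δ fill y
      fill-bilinear i i≤n = begin
        coord fill (2 ℕ.+ i) + coord y (2 ℕ.+ i)
          ≈⟨ +-congʳ (trans (coord-fill i≤n)
               (reflexive (fillTo-stable n (2 ℕ.+ i) i≤n ≤-refl))) ⟩
        fillTo (suc i) (γ i) * coord y (δ i) - coord y (2 ℕ.+ i) + coord y (2 ℕ.+ i)
          ≈⟨ //-rightDividesˡ _ _ ⟩
        fillTo (suc i) (γ i) * coord y (δ i)
          ≈⟨ *-congʳ (reflexive (fillTo-stable (suc i) n (γ≤ i) γi≤n)) ⟩
        fillTo n (γ i) * coord y (δ i)
          ≈⟨ *-congʳ (coord-fill γi≤n) ⟨
        coord fill (γ i) * coord y (δ i)
          ∎
        where
        γi≤n : γ i ≤ n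
        γi≤n = ≤-trans (γ≤ i) (<⇒≤ i≤n)

  module _ {n : ℕ} {p l : Vector Carrier n} where

    incident⇒bilinear : Incident F n p l → Bilinear pointFactor lineFactor p l
    incident⇒bilinear inc 0 2≤n = Incident.eq₂ inc 2≤n
    incident⇒bilinear inc 1 3≤n = Incident.eq₃ inc 3≤n
    incident⇒bilinear inc (suc (suc i)) i≤n
      -- `(4 + i) % 4` computes to `i % 4`, so abstracting this residue also settles the side
      -- conditions of both equations, which are therefore abstracted along with it.
      with i % 4 | m%n<n i 4
         | Incident.eq₀₁ inc (4 ℕ.+ i) (s≤s (s≤s (s≤s (s≤s z≤n)))) i≤n
         | Incident.eq₂₃ inc (4 ℕ.+ i) (s≤s (s≤s (s≤s (s≤s z≤n)))) i≤n
    ... | 0 | _ | eq₀₁ | _    = eq₀₁ (inj₁ ≡.refl)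
    ... | 1 | _ | eq₀₁ | _    = eq₀₁ (inj₂ ≡.refl)
    ... | 2 | _ | _    | eq₂₃ = eq₂₃ (inj₁ ≡.refl)
    ... | 3 | _ | _    | eq₂₃ = eq₂₃ (inj₂ ≡.refl)
    ... | suc (suc (suc (suc _))) | s≤s (s≤s (s≤s (s≤s ()))) | _ | _

    bilinear⇒incident : Bilinear pointFactor lineFactor p l → Incident F n p l
    bilinear⇒incident eqs = record
      { eq₂ = eqs 0 ; eq₃ = eqs 1
      ; eq₀₁ = λ { (suc (suc (suc (suc i)))) (s≤s (s≤s (s≤s (s≤s _)))) i≤n r → low i i≤n r }
      ; eq₂₃ = λ { (suc (suc (suc (suc i)))) (s≤s (s≤s (s≤s (s≤s _)))) i≤n r → high i i≤n r }
      }
      where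
      low : ∀ i → 4 ℕ.+ i ≤ n → i % 4 ≡ 0 ⊎ i % 4 ≡ 1 →
            coord p (4 ℕ.+ i) + coord l (4 ℕ.+ i) ≈ coord p (2 ℕ.+ i) * coord l 1
      low i i≤n r with i % 4 | eqs (2 ℕ.+ i) i≤n
      low i i≤n (inj₁ ≡.refl) | _ | eq = eq
      low i i≤n (inj₂ ≡.refl) | _ | eq = eq

      high : ∀ i → 4 ℕ.+ i ≤ n → i % 4 ≡ 2 ⊎ i % 4 ≡ 3 →
             coord p (4 ℕ.+ i) + coord l (4 ℕ.+ i) ≈ coord p 1 * coord l (2 ℕ.+ i)
      high i i≤n r with i % 4 | eqs (2 ℕ.+ i) i≤n
      high i i≤n (inj₁ ≡.refl) | _ | eq = eq
      high i i≤n (inj₂ ≡.refl) | _ | eq = eq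

    incident? : Dec (Incident F n p l)
    incident? = map′
      (λ eqs → bilinear⇒incident λ i i≤n → eqs (<⇒≤ i≤n) i≤n)
      (λ inc {i} _ → incident⇒bilinear inc i)
      (allUpTo? (λ i → (2 ℕ.+ i ≤? n) →-dec (_ ≈? _)) n)

  -- Chains, walks and cycles in `D F n`.

  module _ (n : ℕ) where
    open NonBacktrackingWalk
    private
      G = D F n
      Vertex = DVertex F n
    open SimpleGraph G using (Adj; adj-sym) renaming (_≈_ to _≈ᵥ_)

    _≈ᵥ?_ : Decidable _≈ᵥ_
    _≈ᵥ?_ = Sum.⊎-decidable (Pointwise.decidable _≈?_) (Pointwise.decidable _≈?_)

    adj? : Decidable Adj
    adj? (inj₁ p) (inj₂ l) = incident?
    adj? (inj₂ l) (inj₁ p) = incident?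
    adj? (inj₁ _) (inj₁ _) = no ⊥-elim
    adj? (inj₂ _) (inj₂ _) = no ⊥-elim

    decode : Fin (q ^ n) → Vector Carrier n
    decode i = to ∘ finToFun i

    encode : Vector Carrier n → Fin (q ^ n)
    encode x = funToFin (from ∘ x)

    decode-encode : ∀ x i → decode (encode x) i ≈ x i
    decode-encode x i = trans (to-cong (finToFun-funToFin (from ∘ x) i)) (strictlyInverseˡ (x i))

    enum : Fin (q ^ n ℕ.+ q ^ n) → Vertex
    enum i = ⊎.map decode decode (splitAt (q ^ n) i)

    enumIndex : Vertex → Fin (q ^ n ℕ.+ q ^ n)
    enumIndex v = join (q ^ n) (q ^ n) (⊎.map encode encode v)

    enum-index : ∀ v → enum (enumIndex v) ≈ᵥ v
    enum-index (inj₁ p) rewrite splitAt-join (q ^ n) (q ^ n) (inj₁ (encode p)) =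
      Sum.inj₁ (decode-encode p)
    enum-index (inj₂ l) rewrite splitAt-join (q ^ n) (q ^ n) (inj₂ (encode l)) =
      Sum.inj₂ (decode-encode l)

    isPoint : Vertex → Bool
    isPoint (inj₁ _) = true
    isPoint (inj₂ _) = false

    isPoint-adj : ∀ x y → Adj x y → isPoint y ≡ not (isPoint x)
    isPoint-adj (inj₁ _) (inj₂ _) _ = ≡.refl
    isPoint-adj (inj₂ _) (inj₁ _) _ = ≡.refl

    entry : Vertex → ℕ → Carrier
    entry v = coord ([ id , id ]′ v)

    -- (1, p₁, p₂, p₃, p₆, p₇, p₁₀, …) for a point and
    -- (1, ℓ₁, ℓ₂, ℓ₄, ℓ₅, ℓ₈, ℓ₉, …) for a line.
    chain : Vertex → ℕ → Carrier
    chain v zero    = 1#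
    chain v (suc j) = entry v (index (isPoint v) j)

    InRange : Vertex → ℕ → Set
    InRange v zero    = ⊤
    InRange v (suc j) = index (isPoint v) j ≤ n

    -- By the choice of `index`, the right side at this coordinate is the first coordinate of `x`
    -- times the preceding chain entry of `y`. The term of `y` on the left cancels in `chain-step`.
    chain-adj : ∀ x y → Adj x y → ∀ j → index (isPoint x) (suc j) ≤ n →
      chain x (2 ℕ.+ j) + entry y (index (isPoint x) (suc j)) ≈ chain x 1 * chain y (suc j)
    chain-adj (inj₁ p) (inj₂ l) inc j j≤n
      with pointFactor (jump j) | pointFactor-jump j | lineFactor (jump j) | lineFactor-jump j
         | incident⇒bilinear inc (jump j) j≤n
    ... | _ | ≡.refl | _ | ≡.refl | eq = eq
    chain-adj (inj₂ l) (inj₁ p) inc zero j≤n = bilinear-sym (incident⇒bilinear inc) 0 j≤n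
    chain-adj (inj₂ l) (inj₁ p) inc (suc j) j≤n
      with pointFactor (2 ℕ.+ jump j) | pointFactor-2+jump j
         | lineFactor (2 ℕ.+ jump j) | lineFactor-2+jump j
         | bilinear-sym (incident⇒bilinear inc) (2 ℕ.+ jump j) j≤n
    ... | _ | ≡.refl | _ | ≡.refl | eq = eq

    chain-step : ∀ {x y z} → Adj x y → Adj y z → ∀ j → InRange x (suc j) →
      chain z (suc j) ≈ chain x (suc j) + (chain z 1 - chain x 1) * chain y j
    chain-step {x} {y} {z} xy yz zero _ = begin
      chain z 1                                  ≈⟨ //-rightDividesˡ _ _ ⟨
      chain z 1 - chain x 1 + chain x 1          ≈⟨ +-comm _ _ ⟩
      chain x 1 + (chain z 1 - chain x 1)        ≈⟨ +-congˡ (*-identityʳ _) ⟨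
      chain x 1 + (chain z 1 - chain x 1) * 1#   ∎
    chain-step {x@(inj₁ _)} {y@(inj₂ _)} {z@(inj₁ _)} xy yz (suc j) r =
      step-solve (chain-adj x y xy j r) (chain-adj z y (adj-sym {y} {z} yz) j r)
    chain-step {x@(inj₂ _)} {y@(inj₁ _)} {z@(inj₂ _)} xy yz (suc j) r =
      step-solve (chain-adj x y xy j r) (chain-adj z y (adj-sym {y} {z} yz) j r)

    neighbours-determined : ∀ {x y z} → Adj x y → Adj y z → chain x 1 ≈ chain z 1 → x ≈ᵥ z
    neighbours-determined {inj₁ _} {inj₂ _} {inj₁ _} xy yz eq = Sum.inj₁
      (bilinear-unique pointFactor≤ (incident⇒bilinear xy) (incident⇒bilinear yz) eq)
    neighbours-determined {inj₂ _} {inj₁ _} {inj₂ _} xy yz eq = Sum.inj₂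
      (bilinear-unique lineFactor≤ (bilinear-sym (incident⇒bilinear xy))
        (bilinear-sym (incident⇒bilinear yz)) eq)

    neighbour : Vertex → Carrier → Vertex
    neighbour (inj₁ p) a = inj₂ (fill {γ = lineFactor} {pointFactor} lineFactor≤ a p)
    neighbour (inj₂ l) a = inj₁ (fill {γ = pointFactor} {lineFactor} pointFactor≤ a l)

    neighbour-adj : ∀ x a → Adj x (neighbour x a)
    neighbour-adj (inj₁ p) a = bilinear⇒incident (bilinear-sym (fill-bilinear lineFactor≤ a p))
    neighbour-adj (inj₂ l) a = bilinear⇒incident (fill-bilinear pointFactor≤ a l)

    neighbour-head : 2 ≤ n → ∀ x a → chain (neighbour x a) 1 ≈ a
    neighbour-head 2≤n (inj₁ p) a = fill-head lineFactor≤ a p (<⇒≤ 2≤n)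
    neighbour-head 2≤n (inj₂ l) a = fill-head pointFactor≤ a l (<⇒≤ 2≤n)

    chain-cong : ∀ {x y} → x ≈ᵥ y → ∀ j → chain x j ≈ chain y j
    chain-cong _            zero    = refl
    chain-cong (Sum.inj₁ p) (suc j) = !-cong F p (index true j)
    chain-cong (Sum.inj₂ l) (suc j) = !-cong F l (index false j)

    pathAt : ℕ → Vertex
    pathAt zero          = inj₁ λ _ → 0#
    pathAt (suc zero)    = neighbour (pathAt 0) 0#
    -- Adding 1 to the first coordinate of the vertex two steps back prevents backtracking, because
    -- `1# ≉ 0#`.
    pathAt (suc (suc i)) = neighbour (pathAt (suc i)) (chain (pathAt i) 1 + 1#)

    path : 2 ≤ n → NonBacktrackingWalk G
    path 2≤n = record
      { at          = pathAt
      ; adjacent    = λ { zero    → neighbour-adj (pathAt 0) 0#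
                      ; (suc i) → neighbour-adj (pathAt (suc i)) _ }
      ; noBacktrack = λ i eq → 1≉0 (+-identityʳ-unique (chain (pathAt i) 1) 1#
          (trans (sym (neighbour-head 2≤n (pathAt (suc i)) _)) (sym (chain-cong eq 1))))
      }

    hasGirth : 2 ≤ n → ∃ (IsGirth G)
    hasGirth 2≤n = cycle⇒girth G enum enumIndex enum-index _≈ᵥ?_ adj?
      (walk⇒cycle G enum enumIndex enum-index _≈ᵥ?_ adj? (path 2≤n) .proj₂)

    module _ (w : NonBacktrackingWalk G) where

      isPoint-walk : ∀ s → isPoint (at w s) ≡
                     alternate (isPoint (at w 0)) (not (isPoint (at w 0))) s
      isPoint-walk = alternates (isPoint ∘ at w) λ i → isPoint-adj _ _ (adjacent w i)

      increment : ℕ → Carrier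
      increment s = chain (at w (2 ℕ.+ s)) 1 - chain (at w s) 1

      -- Two neighbours of one vertex with equal first coordinates coincide, which would be a
      -- backtrack.
      increment≉0 : ∀ s → increment s ≉ 0#
      increment≉0 s ≈0 = noBacktrack w s
        (neighbours-determined (adjacent w s) (adjacent w (suc s)) (sym (x∙y⁻¹≈ε⇒x≈y _ _ ≈0)))

      -- Induction on `s` in steps of two by `chain-step`; for `s` equal to 0 or 1 the continuant is
      -- the unit sequence 1, 0, 0, .... `alternate` puts first the starting chain that belongs to
      -- the side of `at w s`.
      chain-walk : ∀ s j → InRange (at w s) j →
        chain (at w s) j ≈ convolve (continuant increment s)
          (alternate (chain (at w 0)) (chain (at w 1)) s)
          (alternate (chain (at w 1)) (chain (at w 0)) s) j
      chain-walk 0 j _ = sym (convolve-one _ _ refl (λ _ → refl) j)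
      chain-walk 1 j _ = sym (convolve-one _ _ refl (λ _ → refl) j)
      chain-walk (suc (suc s)) zero _ = chain-walk s zero tt
      chain-walk (suc (suc s)) (suc j) r = begin
        chain (at w (2 ℕ.+ s)) (suc j)
          ≈⟨ chain-step (adjacent w s) (adjacent w (suc s)) j r′ ⟩
        chain (at w s) (suc j) + increment s * chain (at w (suc s)) j
          ≈⟨ +-cong (chain-walk s (suc j) r′) (*-congˡ (chain-walk (suc s) j r″)) ⟩
        1# * X (suc j) + convolve (cont s ∘ suc) Y X j +
          increment s * convolve (cont (suc s)) Y X j
          ≈⟨ +-assoc _ _ _ ⟩
        1# * X (suc j) + (convolve (cont s ∘ suc) Y X j +
          increment s * convolve (cont (suc s)) Y X j)
          ≈⟨ +-congˡ (convolve-linear Y X (λ _ → refl) j) ⟨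
        convolve (cont (2 ℕ.+ s)) X Y (suc j)
          ∎
        where
        cont = continuant increment
        X = alternate (chain (at w 0)) (chain (at w 1)) s
        Y = alternate (chain (at w 1)) (chain (at w 0)) s
        r′ : InRange (at w s) (suc j)
        r′ = subst (λ b → index b j ≤ n)
          (≡.trans (isPoint-walk (2 ℕ.+ s)) (≡.sym (isPoint-walk s))) r
        lower : ∀ j → InRange (at w s) (suc j) → InRange (at w (suc s)) j
        lower zero    _ = tt
        lower (suc j) r = ≤-trans
          (≤-reflexive (cong (λ b → index b j) (isPoint-adj _ _ (adjacent w s))))
          (≤-trans (index-not (isPoint (at w s)) j) r)
        r″ : InRange (at w (suc s)) j
        r″ = lower j r′

    noShortClosedWalk : 2 ≤ n → ∀ w m → Periodic G w (m ℕ.+ m) → 2 ≤ m → m ℕ.+ m ≤ 3 ℕ.+ n →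
                        isPoint (at w 0) ≡ true → ⊥
    noShortClosedWalk _ w 1 _ (s≤s ()) _ _
    noShortClosedWalk 2≤n w (suc (suc m)) period _ short point =
      -- Coefficient `M` is nonzero in the forward continuant, of degree `M`, but zero in the
      -- backward one, of degree at most `M - 1`.
      continuant-leading 1≉0 nonZeroProduct (increment w) (increment≉0 w) M
        (trans (convolve-injective-upTo {m = M}
          (alternate-elim StartsWith1 (chain (at w 1)) (chain (at w 0)) refl refl M)
          (alternate-elim StartsWith1 (chain (at w 0)) (chain (at w 1)) refl refl M) agree)
          (continuant-degree (increment w′) M ≤-refl))
      where
      StartsWith1 : (ℕ → Carrier) → Set ℓ
      StartsWith1 Z = Z 0 ≈ 1#
      M = 2 ℕ.+ m
      K = M ℕ.+ suc m
      period′ : Periodic G w (suc K)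
      period′ = subst (Periodic G w) (ℕ.+-suc M (suc m)) period
      -- `at w′ i` is `at w (1 - i)` modulo the length `2M = suc K`, so `w′` starts with `at w 1`,
      -- `at w 0`.
      w′ = reverse G w K period′

      meet : at w′ M ≡ at w (suc M)
      meet = ≡.trans (cong (at w) M*K)
        (periodic-* G w period′ (suc m) (suc M))
        where
        -- That is, `1 + M(2M - 1) = (M + 1) + (M - 1) · 2M`.
        M*K : suc (M ℕ.* K) ≡ suc M ℕ.+ suc m ℕ.* suc K
        M*K = cong suc (≡.trans (ℕ.+-assoc M (suc m) (suc m ℕ.* K))
          (cong (M ℕ.+_) (≡.sym (ℕ.*-suc (suc m) K))))

      start₁ : at w′ 1 ≡ at w 0
      start₁ = ≡.trans (cong (at w ∘ suc) (ℕ.+-identityʳ K)) (period′ 0)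

      inRange : ∀ {j} → j ≤ M → InRange (at w (suc M)) j
      inRange {zero}  _   = tt
      inRange {suc j} j<M = subst (λ b → index b j ≤ n) (≡.sym side)
        (≤-trans (mono (s≤s⁻¹ j<M)) (index-bound m 2≤n short))
        where
        side : isPoint (at w (suc M)) ≡ alternate false true m
        side = ≡.trans (isPoint-walk w (suc M))
          (cong (λ b → alternate (not b) b m) point)
        mono : ∀ {j k b} → j ≤ k → index b j ≤ index b k
        mono {j} {k} {b} j≤k = go (ℕ.≤⇒≤′ j≤k)
          where
          go : ∀ {k} → j ℕ.≤′ k → index b j ≤ index b k
          go (ℕ.≤′-reflexive ≡.refl) = ≤-refl
          go (ℕ.≤′-step j≤k) = ≤-trans (go j≤k) (index-mono b _)

      -- Starting from `w 0`, `w 1` with index `M + 1` gives the same pair of sequences as starting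
      -- from `w 1`, `w 0` with index `M`, so the two expansions differ only in their coefficients.
      X = alternate (chain (at w 1)) (chain (at w 0)) M
      Y = alternate (chain (at w 0)) (chain (at w 1)) M

      agree : ∀ {j} → j ≤ M →
        convolve (continuant (increment w) (suc M)) X Y j ≈
        convolve (continuant (increment w′) M) X Y j
      agree {j} j≤M = trans (sym (chain-walk w (suc M) j (inRange j≤M)))
        (trans (reflexive (cong (λ v → chain v j) (≡.sym meet)))
          (trans (chain-walk w′ M j (subst (λ v → InRange v j) (≡.sym meet) (inRange j≤M)))
            (reflexive (cong (λ v → convolve (continuant (increment w′) M)
                 (alternate (chain (at w 1)) (chain v) M)
                 (alternate (chain v) (chain (at w 1)) M) j)
               start₁))))

    walk-even : ∀ w k → Periodic G w k → ∃[ m ] k ≡ m ℕ.+ m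
    walk-even w k period = alternates⇒even k (isPoint (at w 0))
      (≡.trans (≡.sym (isPoint-walk w k)) (cong isPoint (period 0)))

    cycle-length : 2 ≤ n → ∀ k → Cycle G k → (∃[ m ] k ≡ m ℕ.+ m) × (4 ℕ.+ n ≤ k)
    cycle-length 2≤n k C with cycle⇒walk G C
    ... | w , period with walk-even w k period
    ... | m , ≡.refl = (m , ≡.refl) ,
      ℕ.≮⇒≥ λ { (s≤s short) → tooShort short (isPoint (at w 0)) ≡.refl }
      where
      2≤m : ∀ m → 3 ≤ m ℕ.+ m → 2 ≤ m
      2≤m 0             ()
      2≤m 1             (s≤s (s≤s ()))
      2≤m (suc (suc m)) _ = s≤s (s≤s z≤n)

      tooShort : m ℕ.+ m ≤ 3 ℕ.+ n → ∀ b → isPoint (at w 0) ≡ b → ⊥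
      tooShort short true  point = noShortClosedWalk 2≤n w m period
        (2≤m m (Cycle.length≥3 C)) short point
      -- A cycle that starts at a line is shifted by one vertex to start at a point.
      tooShort short false line  = noShortClosedWalk 2≤n (shift G w) m (λ i → period (suc i))
        (2≤m m (Cycle.length≥3 C)) short (≡.trans (isPoint-adj _ _ (adjacent w 0)) (cong not line))

-- The girth bound, sharpened by parity.

open import Data.Nat.Base using (_+_)

theorem2p4 : ∀ {c ℓ} (q : ℕ) → IsPrimePower q → (F : FiniteField c ℓ q) →
    (n : ℕ) → 2 ≤ n →
    ∃[ g ] (IsGirth (D F n) g × (2 ∤ n → n + 5 ≤ g) × (2 ∣ n → n + 4 ≤ g))
theorem2p4 q _ F n 2≤n with hasGirth F n 2≤n
... | g , girth@(C , _) with cycle-length F n 2≤n g C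
... | (m , ≡.refl) , bound = g , girth , odd , λ _ → ≤-trans (≤-reflexive (ℕ.+-comm n 4)) bound
  where
  -- The girth is even, being `m + m`, while `4 + n` is odd for odd `n`; the bound `4 + n ≤ g` is
  -- then strict.
  4+n≢g : 2 ∤ n → 4 + n ≢ m + m
  4+n≢g 2∤n eq = 2∤n (∣m+n∣m⇒∣n (divides m (≡.trans eq m+m≡m*2)) (divides 2 ≡.refl))
    where
    m+m≡m*2 : m + m ≡ m ℕ.* 2
    m+m≡m*2 = ≡.trans (cong (m +_) (≡.sym (ℕ.+-identityʳ m))) (ℕ.*-comm 2 m)

  odd : 2 ∤ n → n + 5 ≤ m + m
  odd 2∤n = ≤-trans (≤-reflexive (ℕ.+-comm n 5)) (ℕ.≤∧≢⇒< bound (4+n≢g 2∤n))
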